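{- For all integers $k\ge 3$ and $n\ge 1$, $$r_o(C_k,K_{n,n})\;\le\;2n^3+(k-3)\,n(2n-1)+n^2.$$
   Context: An ordered graph $G$ on $n$ vertices has vertex set $[n]=\{1,\dots,n\}$ with the natural linear order. An ordered graph $G$ on $[n]$ is contained in an ordered graph $H$ on a linearly ordered vertex set if there is an injective map $f$ from $[n]$ to $V(H)$ with $f(i)<f(j)$ whenever $i<j$ and $f(i)f(j)\in E(H)$ whenever $ij\in E(G)$; such an image is an ordered copy of $G$. $C_k$ is the ordered cycle on $[k]$ with edges $\{i,i+1\}$ for $1\le i\le k-1$ together with $\{1,k\}$. $K_{n,n}$ is the ordered complete bipartite graph on $[2n]$ with edge set $\{ij: 1\le i\le n<j\le 2n\}$. The online ordered Ramsey game for $(G_1,G_2)$ is played by Builder and Painter on the vertex set $\mathbb N$ with its natural order. On each turn Builder selects a previously unselected pair of vertices (an edge) and Painter then colors it red or blue. Builder wins as soon as the colored edges contain an ordered red copy of $G_1$ or an ordered blue copy of $G_2$; Builder tries to minimize and Painter tries to maximize the number of turns. The online ordered Ramsey number $r_o(G_1,G_2)$ is the number of turns after which Builder wins when both players play optimally. -}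

module Defs where

open import Data.Fin as Fin using (Fin; toℕ)
open import Data.List using (List; []; _∷_)
open import Data.List.Membership.Propositional using (_∈_; _∉_)
open import Data.Nat as ℕ using (ℕ; suc; _+_; _≤_)
open import Data.Nat.Properties using (<-≤-trans)
open import Data.Product using (_×_; _,_; proj₁)
open import Data.Sum using (_⊎_)
open import Function.Definitions using (Injective)
open import Level using (0ℓ)
open import Relation.Binary.Core using (Rel)
open import Relation.Binary.PropositionalEquality using (_≡_)

-- Since the vertices are linearly ordered, an edge {u , v} with u < v is
-- recorded once, as the ordered pair E u v.
record OrderedGraph {V : Set} (_<_ : Rel V 0ℓ) : Set₁ where
  field
    E   : Rel V 0ℓ
    E⇒< : ∀ {u v} → E u v → u < v

open OrderedGraph public

-- The vertices 1 , … , n are represented by the elements 0 , … , n - 1 of Fin n.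
OrderedGraphOn : ℕ → Set₁
OrderedGraphOn n = OrderedGraph {Fin n} Fin._<_

record Copy {n : ℕ} (G : OrderedGraphOn n)
            {V : Set} {_<_ : Rel V 0ℓ} (H : OrderedGraph _<_) : Set where
  field
    f         : Fin n → V
    injective : Injective _≡_ _≡_ f
    monotone  : ∀ {i j} → i Fin.< j → f i < f j
    edges     : ∀ {i j} → E G i j → E H (f i) (f j)

C : (k : ℕ) → OrderedGraphOn k
C k = record
  { E   = λ i j → i Fin.< j ×
                  (toℕ j ≡ suc (toℕ i) ⊎ (toℕ i ≡ 0 × suc (toℕ j) ≡ k))
  ; E⇒< = proj₁
  }

-- K n is the ordered complete bipartite graph with n vertices in each class.
K : (n : ℕ) → OrderedGraphOn (n + n)
K n = record
  { E   = λ i j → toℕ i ℕ.< n × n ≤ toℕ j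
  ; E⇒< = λ (i<n , n≤j) → <-≤-trans i<n n≤j
  }

data Colour : Set where
  red blue : Colour

-- The selected pairs (u , v), always with u < v, and the colours they received.
Position : Set
Position = List ((ℕ × ℕ) × Colour)

colourClass : Colour → Position → OrderedGraph ℕ._<_
colourClass c P = record
  { E   = λ u v → u ℕ.< v × ((u , v) , c) ∈ P
  ; E⇒< = proj₁
  }

module _ {a b : ℕ} (G₁ : OrderedGraphOn a) (G₂ : OrderedGraphOn b) where

  Won : Position → Set
  Won P = Copy G₁ (colourClass red P) ⊎ Copy G₂ (colourClass blue P)

  -- BuilderWins m P: from position P, Builder can force a win within at most
  -- m further turns, whatever Painter does.
  data BuilderWins : ℕ → Position → Set where
    won  : ∀ {m P} → Won P → BuilderWins m P
    turn : ∀ {m P} (u v : ℕ) → u ℕ.< v →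
           (∀ c → ((u , v) , c) ∉ P) →
           (∀ c → BuilderWins m (((u , v) , c) ∷ P)) →
           BuilderWins (suc m) P

  -- r = r_o(G₁ , G₂): Builder can force a win from the empty position within
  -- r turns, and Painter can prevent this for every smaller number of turns.
  IsOnlineOrderedRamseyNumber : ℕ → Set
  IsOnlineOrderedRamseyNumber r =
    BuilderWins r [] × (∀ m → BuilderWins m [] → r ≤ m)

{-# OPTIONS --safe #-}
module Submission where

-- Builder first joins n vertices to 2n² widely spaced vertices above them.  If each
-- of the n has at most 2n - 1 red neighbours, at least n of the 2n² vertices are joined
-- to all of them in blue.  Otherwise some x has 2n red neighbours: call the lower n ends
-- and the upper n tips.  Joining n ends of red paths from x to 2n - 1 fresh vertices
-- below the tips either leaves n of these with only blue edges, a blue K_{n,n}, or gives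
-- n ends of red paths longer by one.  After k - 3 such rounds, a red edge between an end
-- and a tip closes a red C_k, and if there is none we have a blue K_{n,n}.

open import Defs
open import Data.Fin as Fin using (Fin; toℕ; fromℕ<; cast)
open import Data.Fin.Properties as Fin using (all?; any?; toℕ-cast; toℕ-fromℕ<; toℕ<n)
open import Data.List using (List; []; _∷_; _++_; map; length; lookup; filter; take; drop; tabulate; upTo; applyUpTo; cartesianProduct)
open import Data.List.Membership.Propositional using (_∈_; _∉_; find; lose)
open import Data.List.Membership.Propositional.Properties using (∈-++⁺ˡ; ∈-++⁺ʳ; ∈-map⁺; ∈-map⁻; ∈-lookup; ∈-tabulate⁺; ∈-upTo⁻; ∈-applyUpTo⁻; ∈-filter⁻; ∈-cartesianProduct⁺; ∈-cartesianProduct⁻)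
open import Data.List.Properties using (length-++; length-map; length-tabulate; length-take; length-drop; length-filter; length-upTo; length-applyUpTo)
open import Data.List.Relation.Binary.Sublist.Propositional using (_⊆_; []; _∷_; _∷ʳ_; ⊆-refl; ⊆-trans) renaming (lookup to ⊆-lookup)
open import Data.List.Relation.Binary.Sublist.Propositional.Properties using (filter-⊆; take-⊆; All-resp-⊆)
open import Data.List.Relation.Unary.All as All using (All; []; _∷_)
open import Data.List.Relation.Unary.All.Properties as All using (all-filter)
open import Data.List.Relation.Unary.AllPairs as AllPairs using (AllPairs; []; _∷_)
open import Data.List.Relation.Unary.AllPairs.Properties as AllPairs using ()
open import Data.List.Relation.Unary.Any as Any using (here; there)
open import Data.List.Relation.Unary.Unique.Propositional using (Unique)
open import Data.List.Relation.Unary.Unique.Propositional.Properties using (cartesianProduct⁺)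
open import Data.Nat using (ℕ; zero; suc; _+_; _*_; _∸_; _^_; _≤_; _<_; z≤n; s≤s; s≤s⁻¹; _≤?_; _<?_; _≟_)
open import Data.Nat.Properties
open import Data.Nat.Tactic.RingSolver using (solve-∀)
open import Data.Product using (∃-syntax; Σ-syntax; _×_; _,_; proj₁; proj₂)
open import Data.Product.Properties using (≡-dec)
open import Data.Sum using (_⊎_; inj₁; inj₂; [_,_]′)
import Data.Sum as Sum
open import Data.Vec as Vec using (Vec; []; _∷_)
open import Data.Vec.Properties using (lookup∘tabulate)
open import Level using (0ℓ)
open import Function using (_∘_; id)
import Relation.Binary as B
open import Relation.Binary.Definitions using (DecidableEquality; tri<; tri≈; tri>)
open import Relation.Binary.PropositionalEquality using (_≡_; _≗_; refl; sym; trans; cong; cong₂; subst; subst₂; module ≡-Reasoning)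
open import Relation.Nullary using (¬_; Dec; yes; no; contradiction)
open import Relation.Nullary.Decidable using (map′; ¬?; _×-dec_; _⊎-dec_; _→-dec_)
open import Relation.Unary using (Pred; Decidable)
open import Relation.Unary.Properties using (∁?)

-- Deciding which player wins

_≟ᶜ_ : DecidableEquality Colour
red  ≟ᶜ red  = yes refl
red  ≟ᶜ blue = no λ ()
blue ≟ᶜ red  = no λ ()
blue ≟ᶜ blue = yes refl

open import Data.List.Membership.DecPropositional (≡-dec (≡-dec _≟_ _≟_) _≟ᶜ_) using (_∈?_)

∀-colour? : ∀ {P : Colour → Set} → (∀ c → Dec (P c)) → Dec (∀ c → P c)
∀-colour? P? = map′ (λ { (r , b) red → r ; (r , b) blue → b })
                    (λ h → h red , h blue) (P? red ×-dec P? blue)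

any-Vec? : ∀ {N} n {P : Vec (Fin N) n → Set} → (∀ v → Dec (P v)) → Dec (∃[ v ] P v)
any-Vec? zero    P? = map′ ([] ,_) (λ { ([] , p) → p }) (P? [])
any-Vec? (suc n) P? =
  map′ (λ (x , v , p) → (x ∷ v) , p) (λ { ((x ∷ v) , p) → x , v , p })
       (any? λ x → any-Vec? n λ v → P? (x ∷ v))

-- The Ramsey number has to be exhibited as a minimum, not just bounded. Searching upwards from `0`
-- finds it once `P` is decidable, and the known witness `M` stops the search.
least : ∀ {P : ℕ → Set} → (∀ m → Dec (P m)) → ∀ {M} → P M →
        ∃[ r ] ((P r × (∀ m → P m → r ≤ m)) × r ≤ M)
least P? {M} pM with P? 0
least P? {M}     pM | yes p0 = 0 , (p0 , λ _ _ → z≤n) , z≤n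
least P? {zero}  pM | no ¬p0 = contradiction pM ¬p0
least P? {suc M} pM | no ¬p0 with least (P? ∘ suc) pM
... | r , (pr , r-least) , r≤M =
  suc r , (pr , λ { zero p0 → contradiction p0 ¬p0 ; (suc m) pm → s≤s (r-least m pm) }) , s≤s r≤M

-- A form of `Copy` made for decision: on `Fin n` both clauses are finite conjunctions of decidable
-- statements. Injectivity is recovered from strict monotonicity in `IsCopy⇒Copy`.
IsCopy : ∀ {n} → OrderedGraphOn n → Colour → Position → (Fin n → ℕ) → Set
IsCopy G c P f = (∀ i j → i Fin.< j → f i < f j) ×
                 (∀ i j → E G i j → ((f i , f j) , c) ∈ P)

IsCopy-resp-≗ : ∀ {n} {G : OrderedGraphOn n} {c P f g} → f ≗ g → IsCopy G c P f → IsCopy G c P g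
IsCopy-resp-≗ {c = c} {P} f≗g (mono , edge) =
  (λ i j i<j → subst₂ _<_ (f≗g i) (f≗g j) (mono i j i<j)) ,
  (λ i j e → subst₂ (λ u v → ((u , v) , c) ∈ P) (f≗g i) (f≗g j) (edge i j e))

IsCopy⇒Copy : ∀ {n} {G : OrderedGraphOn n} {c P f} → IsCopy G c P f → Copy G (colourClass c P)
IsCopy⇒Copy {G = G} {f = f} (mono , edge) = record
  { f         = f
  ; injective = λ {i} {j} → inj i j
  ; monotone  = λ {i} {j} → mono i j
  ; edges     = λ {i} {j} e → mono i j (E⇒< G e) , edge i j e
  }
  where
  inj : ∀ i j → f i ≡ f j → i ≡ j
  inj i j eq with Fin.<-cmp i j
  ... | tri< i<j _ _ = contradiction eq (<⇒≢ (mono i j i<j))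
  ... | tri≈ _ i≡j _ = i≡j
  ... | tri> _ _ j<i = contradiction (sym eq) (<⇒≢ (mono j i j<i))

-- The game on a bounded vertex set

module _ {a b : ℕ} (G₁ : OrderedGraphOn a) (G₂ : OrderedGraphOn b) where

  -- The embedding is stored as a vector, so that `any-Vec?` can run through all candidates.
  CopyBelow : ∀ {n} → ℕ → OrderedGraphOn n → Colour → Position → Set
  CopyBelow {n} N G c P = ∃[ v ] IsCopy G c P (toℕ ∘ Vec.lookup {A = Fin N} {n} v)

  WonBelow : ℕ → Position → Set
  WonBelow N P = CopyBelow N G₁ red P ⊎ CopyBelow N G₂ blue P

  -- The game with Builder's edges and the winning copies confined to vertices below `N`. Recursion
  -- on the number of turns leaves only finite quantifiers.
  WinsBelow : ℕ → ℕ → Position → Set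
  WinsBelow N zero    P = WonBelow N P
  WinsBelow N (suc m) P = WonBelow N P ⊎
    ∃[ u ] ∃[ v ] (u Fin.< v × (∀ c → ((toℕ u , toℕ v) , c) ∉ P) ×
                   (∀ c → WinsBelow N m (((toℕ {N} u , toℕ {N} v) , c) ∷ P)))

  WonBelow⇒Won : ∀ {N P} → WonBelow N P → Won G₁ G₂ P
  WonBelow⇒Won = Sum.map (IsCopy⇒Copy ∘ proj₂) (IsCopy⇒Copy ∘ proj₂)

  WinsBelow⇒BuilderWins : ∀ {N} m {P} → WinsBelow N m P → BuilderWins G₁ G₂ m P
  WinsBelow⇒BuilderWins zero    w        = won (WonBelow⇒Won w)
  WinsBelow⇒BuilderWins (suc m) (inj₁ w) = won (WonBelow⇒Won w)
  WinsBelow⇒BuilderWins (suc m) (inj₂ (u , v , u<v , fresh , next)) =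
    turn (toℕ u) (toℕ v) u<v fresh (λ c → WinsBelow⇒BuilderWins m (next c))

  module _ (E₁? : B.Decidable (E G₁)) (E₂? : B.Decidable (E G₂)) where

    CopyBelow? : ∀ {n} N (G : OrderedGraphOn n) → B.Decidable (E G) →
                 ∀ c P → Dec (CopyBelow N G c P)
    CopyBelow? {n} N _ E? c P = any-Vec? n λ v →
      (all? λ i → all? λ j → (i Fin.<? j) →-dec (_ <? _)) ×-dec
      (all? λ i → all? λ j → E? i j →-dec (_ ∈? P))

    WonBelow? : ∀ N P → Dec (WonBelow N P)
    WonBelow? N P = CopyBelow? N G₁ E₁? red P ⊎-dec CopyBelow? N G₂ E₂? blue P

    WinsBelow? : ∀ N m P → Dec (WinsBelow N m P)
    WinsBelow? N zero    P = WonBelow? N P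
    WinsBelow? N (suc m) P = WonBelow? N P ⊎-dec
      (any? λ u → any? λ v → (u Fin.<? v) ×-dec
        (∀-colour? λ c → ¬? (_ ∈? P)) ×-dec
        (∀-colour? λ c → WinsBelow? N m _))

  -- Relabelling the vertices of a strategy

  support : ∀ {m P} → BuilderWins G₁ G₂ m P → List ℕ
  support (won (inj₁ φ))    = tabulate (Copy.f φ)
  support (won (inj₂ φ))    = tabulate (Copy.f φ)
  support (turn u v _ _ σ) = u ∷ v ∷ support (σ red) ++ support (σ blue)

  -- This depends on `m` but not on a strategy, so the bounded vertex set can be fixed before any
  -- strategy is known. The last `a + b` allows for a game that is won before its turns run out.
  supportBound : ℕ → ℕ
  supportBound zero    = a + b
  supportBound (suc m) = 2 + (supportBound m + supportBound m) + (a + b)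

  a+b≤supportBound : ∀ m → a + b ≤ supportBound m
  a+b≤supportBound zero    = ≤-refl
  a+b≤supportBound (suc m) = m≤n+m (a + b) (2 + (supportBound m + supportBound m))

  length-support : ∀ {m P} (w : BuilderWins G₁ G₂ m P) → length (support w) ≤ supportBound m
  length-support {m} (won (inj₁ φ)) = begin
    length (tabulate (Copy.f φ)) ≡⟨ length-tabulate (Copy.f φ) ⟩
    a                            ≤⟨ m≤m+n a b ⟩
    a + b                        ≤⟨ a+b≤supportBound m ⟩
    supportBound m               ∎
    where open ≤-Reasoning
  length-support {m} (won (inj₂ φ)) = begin
    length (tabulate (Copy.f φ)) ≡⟨ length-tabulate (Copy.f φ) ⟩
    b                            ≤⟨ m≤n+m b a ⟩
    a + b                        ≤⟨ a+b≤supportBound m ⟩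
    supportBound m               ∎
    where open ≤-Reasoning
  length-support {suc m} (turn u v _ _ σ) = begin
    2 + length (support (σ red) ++ support (σ blue))
      ≡⟨ cong (2 +_) (length-++ (support (σ red))) ⟩
    2 + (length (support (σ red)) + length (support (σ blue)))
      ≤⟨ +-monoʳ-≤ 2 (+-mono-≤ (length-support (σ red)) (length-support (σ blue))) ⟩
    2 + (supportBound m + supportBound m)
      ≤⟨ m≤m+n _ (a + b) ⟩
    supportBound (suc m) ∎
    where open ≤-Reasoning

  module Relabel (S : List ℕ) (N : ℕ) (g : ℕ → ℕ)
                 (g-mono : ∀ {x y} → x ∈ S → x < y → g x < g y)
                 (g-bound : ∀ x → g x < N) where

    g-inj : ∀ {x y} → x ∈ S → y ∈ S → g x ≡ g y → x ≡ y
    g-inj {x} {y} x∈S y∈S eq with <-cmp x y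
    ... | tri< x<y _ _ = contradiction eq (<⇒≢ (g-mono x∈S x<y))
    ... | tri≈ _ x≡y _ = x≡y
    ... | tri> _ _ y<x = contradiction (sym eq) (<⇒≢ (g-mono y∈S y<x))

    move : (ℕ × ℕ) × Colour → (ℕ × ℕ) × Colour
    move ((u , v) , c) = (g u , g v) , c

    ι : ℕ → Fin N
    ι x = fromℕ< (g-bound x)

    toℕ-ι : ∀ x → toℕ (ι x) ≡ g x
    toℕ-ι x = toℕ-fromℕ< (g-bound x)

    VerticesIn : Position → Set
    VerticesIn P = ∀ {u v c} → ((u , v) , c) ∈ P → u ∈ S × v ∈ S

    relabel-copy : ∀ {n} {G : OrderedGraphOn n} {c P} (φ : Copy G (colourClass c P)) →
                   (∀ {x} → x ∈ tabulate (Copy.f φ) → x ∈ S) → CopyBelow N G c (map move P)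
    relabel-copy {G = G} {c} {P} φ ⊆S =
      Vec.tabulate (ι ∘ f) , IsCopy-resp-≗ {G = G} {P = map move P}
        (λ i → sym (trans (cong toℕ (lookup∘tabulate (ι ∘ f) i)) (toℕ-ι (f i))))
        ( (λ i j i<j → g-mono (⊆S (∈-tabulate⁺ i)) (Copy.monotone φ i<j))
        , (λ i j e → ∈-map⁺ move (proj₂ (Copy.edges φ e))))
      where f = Copy.f φ

    WonBelow⇒WinsBelow : ∀ m {P} → WonBelow N P → WinsBelow N m P
    WonBelow⇒WinsBelow zero    w = w
    WonBelow⇒WinsBelow (suc m) w = inj₁ w

    -- The strategy tree is transported along `g` node by node. An unselected edge stays unselected
    -- because `g` is injective on `S`; this is why the vertices of `P` as well as those of the
    -- strategy must lie in `S`. The support includes the winning copies, so these keep their order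
    -- too.
    relabel : ∀ {m P} (w : BuilderWins G₁ G₂ m P) → (∀ {x} → x ∈ support w → x ∈ S) →
              VerticesIn P → WinsBelow N m (map move P)
    relabel {m} (won (inj₁ φ)) ⊆S _ = WonBelow⇒WinsBelow m (inj₁ (relabel-copy φ ⊆S))
    relabel {m} (won (inj₂ φ)) ⊆S _ = WonBelow⇒WinsBelow m (inj₂ (relabel-copy φ ⊆S))
    relabel {suc m} {P} (turn u v u<v fresh σ) ⊆S P⊆S =
      inj₂ (ι u , ι v , subst₂ _<_ (sym (toℕ-ι u)) (sym (toℕ-ι v)) (g-mono u∈S u<v) , fresh′ , next)
      where
      u∈S : u ∈ S
      u∈S = ⊆S (here refl)

      v∈S : v ∈ S
      v∈S = ⊆S (there (here refl))

      fresh′ : ∀ c → ((toℕ (ι u) , toℕ (ι v)) , c) ∉ map move P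
      fresh′ c e rewrite toℕ-ι u | toℕ-ι v with ∈-map⁻ move e
      ... | ((u′ , v′) , c′) , e′ , eq with P⊆S e′
      ...   | u′∈S , v′∈S
        with g-inj u∈S u′∈S (cong (proj₁ ∘ proj₁) eq) | g-inj v∈S v′∈S (cong (proj₂ ∘ proj₁) eq)
      ...     | refl | refl = fresh c′ e′

      P′⊆S : ∀ c → VerticesIn (((u , v) , c) ∷ P)
      P′⊆S c (here refl) = u∈S , v∈S
      P′⊆S c (there e)   = P⊆S e

      ⊆S′ : ∀ c {x} → x ∈ support (σ c) → x ∈ S
      ⊆S′ red  = ⊆S ∘ there ∘ there ∘ ∈-++⁺ˡ
      ⊆S′ blue = ⊆S ∘ there ∘ there ∘ ∈-++⁺ʳ (support (σ red))

      next : ∀ c → WinsBelow N m (((toℕ (ι u) , toℕ (ι v)) , c) ∷ map move P)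
      next c rewrite toℕ-ι u | toℕ-ι v = relabel (σ c) (⊆S′ c) (P′⊆S c)

-- Ranks, and existence of the Ramsey number

module _ {A : Set} {P Q : Pred A 0ℓ} (P? : Decidable P) (Q? : Decidable Q)
         (P⇒Q : ∀ {x} → P x → Q x) where

  length-filter-mono-≤ : ∀ xs → length (filter P? xs) ≤ length (filter Q? xs)
  length-filter-mono-≤ [] = z≤n
  length-filter-mono-≤ (x ∷ xs) with P? x | Q? x
  ... | yes _ | yes _ = s≤s (length-filter-mono-≤ xs)
  ... | yes p | no ¬q = contradiction (P⇒Q p) ¬q
  ... | no _  | yes _ = m≤n⇒m≤1+n (length-filter-mono-≤ xs)
  ... | no _  | no _  = length-filter-mono-≤ xs

  length-filter-mono-< : ∀ {y xs} → y ∈ xs → ¬ P y → Q y →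
                         length (filter P? xs) < length (filter Q? xs)
  length-filter-mono-< {y} {_ ∷ xs} (here refl) ¬p q with P? y | Q? y
  ... | yes p | _     = contradiction p ¬p
  ... | no _  | no ¬q = contradiction q ¬q
  ... | no _  | yes _ = s≤s (length-filter-mono-≤ xs)
  length-filter-mono-< {y} {x ∷ xs} (there y∈xs) ¬p q with P? x | Q? x
  ... | yes _ | yes _ = s≤s (length-filter-mono-< y∈xs ¬p q)
  ... | yes p′ | no ¬q = contradiction (P⇒Q p′) ¬q
  ... | no _  | yes _ = m≤n⇒m≤1+n (length-filter-mono-< y∈xs ¬p q)
  ... | no _  | no _  = length-filter-mono-< y∈xs ¬p q

rank : List ℕ → ℕ → ℕ
rank S x = length (filter (_<? x) S)

-- Everything counted for `x` is counted for `y`, and `x` itself is counted only for `y`.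
-- Repetitions in `S` do no harm.
rank-mono-< : ∀ {S x y} → x ∈ S → x < y → rank S x < rank S y
rank-mono-< {x = x} {y} x∈S x<y =
  length-filter-mono-< (_<? x) (_<? y) (λ s<x → <-trans s<x x<y) x∈S (<-irrefl refl) x<y

module _ {a b : ℕ} (G₁ : OrderedGraphOn a) (G₂ : OrderedGraphOn b)
         (E₁? : B.Decidable (E G₁)) (E₂? : B.Decidable (E G₂)) where

  -- A strategy is a finite tree, so replacing each of its vertices by its rank
  -- among them turns it into a strategy on a vertex set bounded in terms of m.
  BuilderWins? : ∀ m → Dec (BuilderWins G₁ G₂ m [])
  BuilderWins? m = map′ (WinsBelow⇒BuilderWins G₁ G₂ m) compress (WinsBelow? G₁ G₂ E₁? E₂? N m [])
    where
    N = suc (supportBound G₁ G₂ m)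

    compress : BuilderWins G₁ G₂ m [] → WinsBelow G₁ G₂ N m []
    compress w = Relabel.relabel G₁ G₂ S N (rank S) rank-mono-<
      (λ x → s≤s (≤-trans (length-filter (_<? x) S) (length-support G₁ G₂ w))) w id (λ ())
      where S = support G₁ G₂ w

  -- This reduces an upper bound on the Ramsey number to a single strategy for Builder.
  onlineOrderedRamseyNumber-≤ : ∀ {M} → BuilderWins G₁ G₂ M [] →
    ∃[ r ] (IsOnlineOrderedRamseyNumber G₁ G₂ r × r ≤ M)
  onlineOrderedRamseyNumber-≤ = least BuilderWins?

C-E? : ∀ k → B.Decidable (E (C k))
C-E? k i j = (i Fin.<? j) ×-dec
  ((toℕ j ≟ suc (toℕ i)) ⊎-dec ((toℕ i ≟ 0) ×-dec (suc (toℕ j) ≟ k)))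

K-E? : ∀ n → B.Decidable (E (K n))
K-E? n i j = (toℕ i <? n) ×-dec (n ≤? toℕ j)


-- Sorted lists and pigeonhole

private
  variable
    A : Set
    R : B.Rel A 0ℓ

AllPairs-resp-⊆ : ∀ {xs ys} → xs ⊆ ys → AllPairs R ys → AllPairs R xs
AllPairs-resp-⊆ []         []       = []
AllPairs-resp-⊆ (_ ∷ʳ τ)   (_ ∷ ps) = AllPairs-resp-⊆ τ ps
AllPairs-resp-⊆ (refl ∷ τ) (p ∷ ps) = All-resp-⊆ τ p ∷ AllPairs-resp-⊆ τ ps

AllPairs-lookup : ∀ {xs} → AllPairs R xs → ∀ i j → i Fin.< j → R (lookup xs i) (lookup xs j)
AllPairs-lookup (p ∷ ps) Fin.zero    (Fin.suc j) _         = All.lookup p (∈-lookup j)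
AllPairs-lookup (p ∷ ps) (Fin.suc i) (Fin.suc j) (s≤s i<j) = AllPairs-lookup ps i j i<j

lookup-++-∈ˡ : ∀ (xs ys : List A) i → toℕ i < length xs → lookup (xs ++ ys) i ∈ xs
lookup-++-∈ˡ (x ∷ xs) ys Fin.zero    _         = here refl
lookup-++-∈ˡ (x ∷ xs) ys (Fin.suc i) (s≤s i<n) = there (lookup-++-∈ˡ xs ys i i<n)

lookup-++-∈ʳ : ∀ (xs ys : List A) i → length xs ≤ toℕ i → lookup (xs ++ ys) i ∈ ys
lookup-++-∈ʳ []       ys i           _         = ∈-lookup i
lookup-++-∈ʳ (x ∷ xs) ys (Fin.suc i) (s≤s n≤i) = lookup-++-∈ʳ xs ys i n≤i

length-take-≤ : ∀ {n} (xs : List A) → n ≤ length xs → length (take n xs) ≡ n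
length-take-≤ {n = n} xs n≤ = trans (length-take n xs) (m≤n⇒m⊓n≡m n≤)

sorted⇒unique : ∀ {xs} → AllPairs _<_ xs → Unique xs
sorted⇒unique = AllPairs.map <⇒≢

length-cartesianProduct : ∀ {A B : Set} (xs : List A) (ys : List B) →
                          length (cartesianProduct xs ys) ≡ length xs * length ys
length-cartesianProduct []       ys = refl
length-cartesianProduct (x ∷ xs) ys = trans (length-++ (map (x ,_) ys))
  (cong₂ _+_ (length-map (x ,_) ys) (length-cartesianProduct xs ys))

module _ {P : Pred A 0ℓ} (P? : Decidable P) where

  length-filter-∁ : ∀ xs → length (filter P? xs) + length (filter (∁? P?) xs) ≡ length xs
  length-filter-∁ [] = refl
  length-filter-∁ (x ∷ xs) with P? x
  ... | yes _ = cong suc (length-filter-∁ xs)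
  ... | no  _ = trans (+-suc _ _) (cong suc (length-filter-∁ xs))

  -- The two filtered lists partition `xs`. If both alternatives failed, `xs` would have at most
  -- `p + q - 2` elements; hence the `suc` in the hypothesis.
  filter-pigeonhole : ∀ p {q} xs → p + q ≤ suc (length xs) →
    p ≤ length (filter P? xs) ⊎ q ≤ length (filter (∁? P?) xs)
  filter-pigeonhole p {q} xs p+q≤ with p ≤? length (filter P? xs)
  ... | yes p≤ = inj₁ p≤
  ... | no  p≰ = inj₂ (+-cancelˡ-≤ (suc s) q t (begin
    suc s + q       ≤⟨ +-monoˡ-≤ q (≰⇒> p≰) ⟩
    p + q           ≤⟨ p+q≤ ⟩
    suc (length xs) ≡⟨ cong suc (length-filter-∁ xs) ⟨
    suc s + t       ∎))
    where
    open ≤-Reasoning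
    s = length (filter P? xs)
    t = length (filter (∁? P?) xs)

-- The vertices of `xs` are treated in turn: one with more than `d` neighbours among the remaining
-- candidates is the centre of the star, and otherwise its neighbours are discarded. Each vertex
-- thus costs at most `d` candidates, which is what `length xs * d` pays for.
star-or-empty-biclique : {_~_ : B.Rel A 0ℓ} → B.Decidable _~_ → ∀ d m xs ys →
  length xs * d + m ≤ length ys →
  (∃[ x ] ∃[ zs ] (x ∈ xs × zs ⊆ ys × suc d ≤ length zs × All (x ~_) zs)) ⊎
  (∃[ zs ] (zs ⊆ ys × m ≤ length zs × (∀ {x z} → x ∈ xs → z ∈ zs → ¬ x ~ z)))
star-or-empty-biclique _~?_ d m [] ys m≤ = inj₂ (ys , ⊆-refl , m≤ , λ ())
star-or-empty-biclique _~?_ d m (x ∷ xs) ys ≤ys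
  with filter-pigeonhole (x ~?_) (suc d) ys (s≤s (≤-trans (≤-reflexive (sym (+-assoc d _ m))) ≤ys))
... | inj₁ d< = inj₁ (x , _ , here refl , filter-⊆ (x ~?_) ys , d< , all-filter (x ~?_) ys)
... | inj₂ ≤zs with star-or-empty-biclique _~?_ d m xs (filter (∁? (x ~?_)) ys) ≤zs
...   | inj₁ (x′ , zs , x′∈ , zs⊆ , d< , all) =
        inj₁ (x′ , zs , there x′∈ , ⊆-trans zs⊆ (filter-⊆ (∁? (x ~?_)) ys) , d< , all)
...   | inj₂ (zs , zs⊆ , m≤ , none) =
        inj₂ (zs , ⊆-trans zs⊆ (filter-⊆ (∁? (x ~?_)) ys) , m≤ ,
          λ { (here refl) z∈ → All.lookup (All-resp-⊆ zs⊆ (all-filter (∁? (x ~?_)) ys)) z∈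
            ; (there x′∈) z∈ → none x′∈ z∈ })

-- The cut `b` is the `n`-th element, and everything after it lies more than `g` higher. The
-- vertices between are kept free for lengthening the red paths.
separated : ∀ {g} n → 1 ≤ n → ∀ {xs} → AllPairs (λ x y → x + g < y) xs → n ≤ length xs →
  ∃[ b ] (All (_≤ b) (take n xs) × All (b + g <_) (drop n xs))
separated (suc zero) _ {x ∷ xs} (p ∷ _) _ = x , (≤-refl ∷ []) , p
separated {g} (suc (suc n)) _ {x ∷ y ∷ xs} ((x+g<y ∷ _) ∷ ps) (s≤s n<)
  with separated (suc n) (s≤s z≤n) ps n<
... | b , (y≤b ∷ ≤b) , b< =
  b , (≤-trans (<⇒≤ (≤-<-trans (m≤m+n x g) x+g<y)) y≤b ∷ y≤b ∷ ≤b) , b<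

-- Copies of the two graphs

K-copy : ∀ {n c Q X Y} → length X ≡ n → length Y ≡ n → AllPairs _<_ X → AllPairs _<_ Y →
  (∀ {x y} → x ∈ X → y ∈ Y → x < y × ((x , y) , c) ∈ Q) → Copy (K n) (colourClass c Q)
K-copy {n} {c} {Q} {X} {Y} |X| |Y| X-sorted Y-sorted joined = IsCopy⇒Copy {G = K n} {P = Q} {f = f}
  ( (λ i j i<j → AllPairs-lookup XY-sorted (ι i) (ι j)
                   (subst₂ _<_ (sym (toℕ-cast eq i)) (sym (toℕ-cast eq j)) i<j))
  , (λ i j (i<n , n≤j) → proj₂ (joined
      (lookup-++-∈ˡ X Y (ι i) (subst₂ _<_ (sym (toℕ-cast eq i)) (sym |X|) i<n))
      (lookup-++-∈ʳ X Y (ι j) (subst₂ _≤_ (sym |X|) (sym (toℕ-cast eq j)) n≤j)))))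
  where
  eq : n + n ≡ length (X ++ Y)
  eq = sym (trans (length-++ X) (cong₂ _+_ |X| |Y|))

  ι : Fin (n + n) → Fin (length (X ++ Y))
  ι = cast eq

  f : Fin (n + n) → ℕ
  f i = lookup (X ++ Y) (ι i)

  XY-sorted : AllPairs _<_ (X ++ Y)
  XY-sorted = AllPairs.++⁺ X-sorted Y-sorted
    (All.tabulate λ x∈ → All.tabulate λ y∈ → proj₁ (joined x∈ y∈))

RedEdge : Position → ℕ → ℕ → Set
RedEdge Q = E (colourClass red Q)

-- A path is a function on all of `ℕ` whose values beyond `l` are arbitrary, so paths of all lengths
-- share one type. It is increasing because `RedEdge` includes `u < v`.
RedPath : Position → ℕ → ℕ → ℕ → Set
RedPath Q l x y = Σ[ p ∈ (ℕ → ℕ) ] (p 0 ≡ x × p l ≡ y × (∀ i → i < l → RedEdge Q (p i) (p (suc i))))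

RedPath-mono : ∀ {P Q l x y} → (∀ {e} → e ∈ P → e ∈ Q) → RedPath P l x y → RedPath Q l x y
RedPath-mono P⊆Q (p , p0 , pl , steps) =
  p , p0 , pl , λ i i<l → proj₁ (steps i i<l) , P⊆Q (proj₂ (steps i i<l))

RedPath-edge : ∀ {Q x y} → RedEdge Q x y → RedPath Q 1 x y
RedPath-edge {x = x} {y} e =
  (λ { zero → x ; (suc _) → y }) , refl , refl , λ { zero _ → e ; (suc _) (s≤s ()) }

RedPath-snoc : ∀ {Q l x y z} → RedPath Q l x y → RedEdge Q y z → RedPath Q (suc l) x z
RedPath-snoc {Q} {l} {x} {y} {z} (p , p0 , pl , steps) e = p′ , p0 , p′-last , steps′
  where
  p′ : ℕ → ℕ
  p′ i with i ≤? l
  ... | yes _ = p i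
  ... | no  _ = z

  p′-init : ∀ {i} → i ≤ l → p′ i ≡ p i
  p′-init {i} i≤l with i ≤? l
  ... | yes _ = refl
  ... | no i≰l = contradiction i≤l i≰l

  p′-last : p′ (suc l) ≡ z
  p′-last with suc l ≤? l
  ... | yes l<l = contradiction l<l (<-irrefl refl)
  ... | no _ = refl

  steps′ : ∀ i → i < suc l → RedEdge Q (p′ i) (p′ (suc i))
  steps′ i (s≤s i≤l) with m≤n⇒m<n∨m≡n i≤l
  ... | inj₁ i<l  = subst₂ (RedEdge Q) (sym (p′-init i≤l)) (sym (p′-init i<l)) (steps i i<l)
  ... | inj₂ refl = subst₂ (RedEdge Q) (sym (trans (p′-init i≤l) pl)) (sym p′-last) e

-- The path gives the consecutive edges, and the chord from `x` to `y` gives the edge between the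
-- first and the last vertex.
C-copy : ∀ {l Q x y} → RedPath Q l x y → RedEdge Q x y → Copy (C (suc l)) (colourClass red Q)
C-copy {l} {Q} {x} {y} (p , p0 , pl , steps) xy =
  IsCopy⇒Copy {G = C (suc l)} {P = Q} {f = p ∘ toℕ} ((λ i j i<j → increasing i<j (s≤s⁻¹ (toℕ<n j))) , edge)
  where
  increasing : ∀ {i j} → i < j → j ≤ l → p i < p j
  increasing {i} {suc j} (s≤s i≤j) j<l with m≤n⇒m<n∨m≡n i≤j
  ... | inj₁ i<j  = <-trans (increasing i<j (<⇒≤ j<l)) (proj₁ (steps j j<l))
  ... | inj₂ refl = proj₁ (steps i j<l)

  edge : ∀ i j → E (C (suc l)) i j → ((p (toℕ i) , p (toℕ j)) , red) ∈ Q
  edge i j (_ , inj₁ j≡1+i) rewrite j≡1+i =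
    proj₂ (steps (toℕ i) (s≤s⁻¹ (subst (_< suc l) j≡1+i (toℕ<n j))))
  edge i j (_ , inj₂ (i≡0 , 1+j≡1+l)) rewrite i≡0 | suc-injective 1+j≡1+l | p0 | pl = proj₂ xy


-- Builder's strategy

module _ {a b : ℕ} (G₁ : OrderedGraphOn a) (G₂ : OrderedGraphOn b) where

  -- Builder selects all of `L` whatever the replies and looks at the colours only afterwards. The
  -- continuation sees the final position only through its properties, so the order of the moves is
  -- forgotten.
  draw : ∀ L {m P} → Unique L → (∀ {u v} → (u , v) ∈ L → u < v × (∀ c → ((u , v) , c) ∉ P)) →
    (∀ Q → (∀ {e} → e ∈ P → e ∈ Q) → (∀ {e c} → (e , c) ∈ Q → (e , c) ∈ P ⊎ e ∈ L) →
           (∀ {e} → e ∈ L → ∃[ c ] (e , c) ∈ Q) → BuilderWins G₁ G₂ m Q) →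
    BuilderWins G₁ G₂ (length L + m) P
  draw [] {P = P} _ _ continue = continue P id inj₁ (λ ())
  draw ((u , v) ∷ L) {m} {P} (e∉L ∷ L!) valid continue =
    turn u v (proj₁ (valid (here refl))) (proj₂ (valid (here refl))) λ c →
      draw L L! (valid′ c) λ Q ⊆Q Q⊆ coloured → continue Q (⊆Q ∘ there)
        (λ q → new (Q⊆ q))
        (λ { (here refl) → c , ⊆Q (here refl) ; (there e∈L) → coloured e∈L })
    where
    valid′ : ∀ c {u′ v′} → (u′ , v′) ∈ L →
             u′ < v′ × (∀ c′ → ((u′ , v′) , c′) ∉ (((u , v) , c) ∷ P))
    valid′ c e∈L with valid (there e∈L)
    ... | u<v , fresh = u<v , λ
      { c′ (here refl) → All.lookup e∉L e∈L refl
      ; c′ (there e∈P) → fresh c′ e∈P }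

    new : ∀ {c e c′} → (e , c′) ∈ (((u , v) , c) ∷ P) ⊎ e ∈ L → (e , c′) ∈ P ⊎ e ∈ ((u , v) ∷ L)
    new (inj₁ (here refl)) = inj₂ (here refl)
    new (inj₁ (there e∈P)) = inj₁ e∈P
    new (inj₂ e∈L)         = inj₂ (there e∈L)

  -- `old` preserves red paths and chords, `new` shows that later edges are still unselected, and
  -- `coloured` makes every pair that is not red blue.
  record Drawn (X Y : List ℕ) (P Q : Position) : Set where
    field
      old      : ∀ {e} → e ∈ P → e ∈ Q
      new      : ∀ {u v c} → ((u , v) , c) ∈ Q → ((u , v) , c) ∈ P ⊎ (u ∈ X × v ∈ Y)
      coloured : ∀ {x y} → x ∈ X → y ∈ Y → ∃[ c ] ((x , y) , c) ∈ Q

  draw-biclique : ∀ X Y {m P} → AllPairs _<_ X → AllPairs _<_ Y →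
    (∀ {x y} → x ∈ X → y ∈ Y → x < y × (∀ c → ((x , y) , c) ∉ P)) →
    (∀ Q → Drawn X Y P Q → BuilderWins G₁ G₂ m Q) →
    BuilderWins G₁ G₂ (length X * length Y + m) P
  draw-biclique X Y {m} {P} X-sorted Y-sorted valid continue =
    subst (λ l → BuilderWins G₁ G₂ (l + m) P) (length-cartesianProduct X Y)
      (draw (cartesianProduct X Y)
        (cartesianProduct⁺ (sorted⇒unique X-sorted) (sorted⇒unique Y-sorted))
        (λ e∈ → let x∈ , y∈ = ∈-cartesianProduct⁻ X Y e∈ in valid x∈ y∈)
        (λ Q old new coloured → continue Q record
          { old      = old
          ; new      = Sum.map₂ (∈-cartesianProduct⁻ X Y) ∘ new
          ; coloured = λ x∈ y∈ → coloured (∈-cartesianProduct⁺ x∈ y∈) }))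

IsRed : Position → ℕ → ℕ → Set
IsRed Q u v = ((u , v) , red) ∈ Q

isRed? : ∀ Q → B.Decidable (IsRed Q)
isRed? Q u v = _ ∈? Q

-- `d` is `2 * n ∸ 1`, described by an equation that avoids truncated subtraction.
module Strategy (k n d : ℕ) (1+d≡n+n : suc d ≡ n + n) where

  Wins : ℕ → Position → Set
  Wins = BuilderWins (C k) (K n)

  blue-biclique-wins : ∀ {m Q X Y} → length X ≡ n → n ≤ length Y →
    AllPairs _<_ X → AllPairs _<_ Y → (∀ {x y} → x ∈ X → y ∈ Y → x < y) →
    (∀ {x y} → x ∈ X → y ∈ Y → ∃[ c ] ((x , y) , c) ∈ Q) →
    (∀ {x y} → x ∈ X → y ∈ Y → ¬ IsRed Q x y) → Wins m Q
  blue-biclique-wins {Q = Q} {X} {Y} |X| n≤|Y| X-sorted Y-sorted X<Y coloured ¬red =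
    won (inj₂ (K-copy |X| (length-take-≤ Y n≤|Y|) X-sorted (AllPairs.take⁺ n Y-sorted)
      (λ x∈ y∈ → let y∈Y = ⊆-lookup (take-⊆ n Y) y∈ in
        X<Y x∈ y∈Y , blue-edge (coloured x∈ y∈Y) (¬red x∈ y∈Y))))
    where
    blue-edge : ∀ {e} → ∃[ c ] (e , c) ∈ Q → ¬ (e , red) ∈ Q → (e , blue) ∈ Q
    blue-edge (red  , e) ¬r = contradiction e ¬r
    blue-edge (blue , e) _  = e

  -- Red paths with l edges lead from the apex to each end, and red chords from
  -- the apex to each tip; j extensions of the paths by an edge are still to come,
  -- each using up d vertices of the gap between b and the tips.
  record Fan (j : ℕ) (Q : Position) : Set where
    field
      apex b l    : ℕ
      ends tips   : List ℕ
      ends-length : length ends ≡ n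
      tips-length : length tips ≡ n
      ends-sorted : AllPairs _<_ ends
      tips-sorted : AllPairs _<_ tips
      n≤ends      : All (n ≤_) ends
      ends≤b      : All (_≤ b) ends
      gap         : All (b + j * d <_) tips
      paths       : All (RedPath Q l apex) ends
      chords      : All (RedEdge Q apex) tips
      edge-count  : k ≡ 2 + (l + j)
      origin      : ∀ {u v c} → ((u , v) , c) ∈ Q → u < n ⊎ v ≤ b

    -- The opening edges start below `n`, and the edges of the extension rounds end at or below the
    -- current `b`. An edge from an end to a vertex above `b` does neither.
    fresh : ∀ {u v} → u ∈ ends → b < v → ∀ c → ((u , v) , c) ∉ Q
    fresh u∈ b<v c e with origin e
    ... | inj₁ u<n = <⇒≱ u<n (All.lookup n≤ends u∈)
    ... | inj₂ v≤b = <⇒≱ b<v v≤b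

  close : ∀ {Q} → Fan 0 Q → Wins (n * n) Q
  close {Q} fan =
    subst (λ m → Wins m Q) (trans (+-identityʳ _) (cong₂ _*_ ends-length tips-length))
      (draw-biclique (C k) (K n) ends tips ends-sorted tips-sorted
        (λ x∈ y∈ → ends<tips x∈ y∈ , fresh x∈ (b<tips y∈)) finish)
    where
    open Fan fan

    b<tips : ∀ {y} → y ∈ tips → b < y
    b<tips y∈ = ≤-<-trans (m≤m+n b 0) (All.lookup gap y∈)

    ends<tips : ∀ {x y} → x ∈ ends → y ∈ tips → x < y
    ends<tips x∈ y∈ = ≤-<-trans (All.lookup ends≤b x∈) (b<tips y∈)

    finish : ∀ Q′ → Drawn (C k) (K n) ends tips Q Q′ → Wins 0 Q′
    finish Q′ drawn with Any.any? (λ x → Any.any? (isRed? Q′ x) tips) ends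
    ... | no ¬any = blue-biclique-wins ends-length (≤-reflexive (sym tips-length))
      ends-sorted tips-sorted ends<tips coloured
      (λ x∈ y∈ r → ¬any (lose x∈ (lose y∈ r)))
      where open Drawn drawn
    ... | yes some with find some
    ...   | x , x∈ , some′ with find some′
    ...     | y , y∈ , r = won (inj₁ (subst (λ k → Copy (C k) (colourClass red Q′)) (sym k≡)
      (C-copy
        (RedPath-snoc (RedPath-mono old (All.lookup paths x∈)) (ends<tips x∈ y∈ , r))
        (let a<y , e = All.lookup chords y∈ in a<y , old e))))
      where
      open Drawn drawn
      -- The two edges besides the path are the one from the end to the tip and the chord from the
      -- apex to that tip.
      k≡ : k ≡ 2 + l
      k≡ = trans edge-count (cong (2 +_) (+-identityʳ l))

  extend : ∀ j {Q} → Fan j Q → Wins (j * (n * d) + n * n) Q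
  extend zero    fan = close fan
  extend (suc j) {Q} fan = subst (λ m → Wins m Q) budget
    (draw-biclique (C k) (K n) ends news ends-sorted news-sorted
      (λ x∈ y∈ → ends<news x∈ y∈ , fresh x∈ (b<news y∈)) continue)
    where
    open Fan fan

    news : List ℕ
    -- The first `d` vertices above `b`. Since `suc j * d` is `d + j * d`, they lie below the tips
    -- and leave room for the other `j` rounds.
    news = applyUpTo (λ i → suc (b + i)) d

    news-sorted : AllPairs _<_ news
    news-sorted = AllPairs.applyUpTo⁺₁ _ d (λ i<j _ → s≤s (+-monoʳ-< b i<j))

    b<news : ∀ {y} → y ∈ news → b < y
    b<news y∈ with ∈-applyUpTo⁻ _ y∈
    ... | i , _ , refl = s≤s (m≤m+n b i)

    news≤b+d : ∀ {y} → y ∈ news → y ≤ b + d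
    news≤b+d y∈ with ∈-applyUpTo⁻ _ y∈
    ... | i , i<d , refl = +-monoʳ-< b i<d

    ends<news : ∀ {x y} → x ∈ ends → y ∈ news → x < y
    ends<news x∈ y∈ = ≤-<-trans (All.lookup ends≤b x∈) (b<news y∈)

    budget : length ends * length news + (j * (n * d) + n * n) ≡ suc j * (n * d) + n * n
    budget rewrite ends-length | length-applyUpTo (λ i → suc (b + i)) d = sym (+-assoc (n * d) _ _)

    continue : ∀ Q′ → Drawn (C k) (K n) ends news Q Q′ → Wins (j * (n * d) + n * n) Q′
    -- As `d` is `n + n - 1`, either `n` new vertices receive a red edge from some end, and become
    -- the next ends, or `n` receive none.
    continue Q′ drawn with filter-pigeonhole (λ y → Any.any? (λ x → isRed? Q′ x y) ends) n news
      (≤-reflexive (trans (sym 1+d≡n+n) (cong suc (sym (length-applyUpTo _ d)))))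
    ... | inj₂ n≤ = blue-biclique-wins ends-length n≤ ends-sorted (AllPairs.filter⁺ _ news-sorted)
        (λ x∈ y∈ → ends<news x∈ (proj₁ (∈-filter⁻ _ y∈)))
        (λ x∈ y∈ → coloured x∈ (proj₁ (∈-filter⁻ _ y∈)))
        (λ x∈ y∈ r → proj₂ (∈-filter⁻ _ {xs = news} y∈) (lose x∈ r))
      where open Drawn drawn
    ... | inj₁ n≤ = extend j record
      { apex        = apex
      ; b           = b + d
      ; l           = suc l
      ; ends        = take n reached
      ; tips        = tips
      ; ends-length = length-take-≤ reached n≤
      ; tips-length = tips-length
      ; ends-sorted = AllPairs.take⁺ n (AllPairs.filter⁺ _ news-sorted)
      ; tips-sorted = tips-sorted
      ; n≤ends      = All.tabulate (λ y∈ → let _ , x , x∈ , x<y , _ = reached⁻ y∈ in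
                        ≤-trans (All.lookup n≤ends x∈) (<⇒≤ x<y))
      ; ends≤b      = All.tabulate (λ y∈ → news≤b+d (proj₁ (reached⁻ y∈)))
      ; gap         = All.map (≤-trans (s≤s (≤-reflexive (+-assoc b d (j * d))))) gap
      ; paths       = All.tabulate (λ y∈ → let _ , x , x∈ , xy = reached⁻ y∈ in
                        RedPath-snoc (RedPath-mono old (All.lookup paths x∈)) xy)
      ; chords      = All.map (λ (a<y , e) → a<y , old e) chords
      ; edge-count  = trans edge-count (cong (2 +_) (+-suc l j))
      ; origin      = origin′
      }
      where
      open Drawn drawn

      reached : List ℕ
      reached = filter (λ y → Any.any? (λ x → isRed? Q′ x y) ends) news

      reached⁻ : ∀ {y} → y ∈ take n reached → y ∈ news × ∃[ x ] (x ∈ ends × RedEdge Q′ x y)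
      reached⁻ y∈ with ∈-filter⁻ _ {xs = news} (⊆-lookup (take-⊆ n reached) y∈)
      ... | y∈news , any with find any
      ...   | x , x∈ , r = y∈news , x , x∈ , ends<news x∈ y∈news , r

      origin′ : ∀ {u v c} → ((u , v) , c) ∈ Q′ → u < n ⊎ v ≤ b + d
      origin′ e with new e
      ... | inj₁ e∈Q    = Sum.map₂ (λ v≤b → ≤-trans v≤b (m≤m+n b d)) (origin e∈Q)
      ... | inj₂ (_ , v∈) = inj₂ (news≤b+d v∈)

  start : 1 ≤ n → ∀ j → k ≡ 3 + j → Wins (n * (n * d + n) + (j * (n * d) + n * n)) []
  start 1≤n j k≡ = subst (λ m → Wins (m + (j * (n * d) + n * n)) [])
    (cong₂ _*_ (length-upTo n) (length-applyUpTo _ (n * d + n)))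
    (draw-biclique (C k) (K n) left right left-sorted right-sorted
      (λ x∈ y∈ → left<right x∈ y∈ , λ _ ()) continue)
    where
    -- Room for `j` rounds of `d` vertices. Painter's replies decide where ends and tips are
    -- separated, so every gap in `right` must be this wide.
    g : ℕ
    g = j * d

    left right : List ℕ
    left  = upTo n
    -- Steps of `suc g` leave `g` vertices strictly between neighbours. The number of vertices is
    -- `2n²`: each vertex of `left` may rule out `d`, and `n` must survive.
    right = applyUpTo (λ i → n + i * suc g) (n * d + n)

    left-sorted : AllPairs _<_ left
    left-sorted = AllPairs.applyUpTo⁺₁ id n (λ i<j _ → i<j)

    right-spread : AllPairs (λ x y → x + g < y) right
    right-spread = AllPairs.applyUpTo⁺₁ _ _ (λ {i} {i′} i<i′ _ → begin-strict
      n + i * suc g + g   ≡⟨ +-assoc n _ g ⟩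
      n + (i * suc g + g) <⟨ +-monoʳ-< n (begin
        suc (i * suc g + g) ≡⟨ cong suc (+-comm _ g) ⟩
        suc i * suc g       ≤⟨ *-monoˡ-≤ (suc g) i<i′ ⟩
        i′ * suc g          ∎) ⟩
      n + i′ * suc g      ∎)
      where open ≤-Reasoning

    spread⇒sorted : ∀ {xs} → AllPairs (λ x y → x + g < y) xs → AllPairs _<_ xs
    spread⇒sorted = AllPairs.map (≤-<-trans (m≤m+n _ g))

    right-sorted : AllPairs _<_ right
    right-sorted = spread⇒sorted right-spread

    n≤right : ∀ {y} → y ∈ right → n ≤ y
    n≤right y∈ with ∈-applyUpTo⁻ _ y∈
    ... | i , _ , refl = m≤m+n n _

    left<right : ∀ {x y} → x ∈ left → y ∈ right → x < y
    left<right x∈ y∈ = <-≤-trans (∈-upTo⁻ x∈) (n≤right y∈)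

    continue : ∀ Q → Drawn (C k) (K n) left right [] Q → Wins (j * (n * d) + n * n) Q
    continue Q drawn with star-or-empty-biclique (isRed? Q) d n left right
      (≤-reflexive (trans (cong (λ l → l * d + n) (length-upTo n)) (sym (length-applyUpTo _ (n * d + n)))))
    ... | inj₂ (zs , zs⊆ , n≤ , ¬red) =
      blue-biclique-wins (length-upTo n) n≤ left-sorted (AllPairs-resp-⊆ zs⊆ right-sorted)
        (λ x∈ z∈ → left<right x∈ (⊆-lookup zs⊆ z∈))
        (λ x∈ z∈ → coloured x∈ (⊆-lookup zs⊆ z∈))
        ¬red
      where open Drawn drawn
    ... | inj₁ (x , zs , x∈ , zs⊆ , 2n≤ , reds) = fan-wins
      where
      open Drawn drawn

      n+n≤ : n + n ≤ length zs
      n+n≤ = subst (_≤ length zs) 1+d≡n+n 2n≤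

      zs-spread : AllPairs (λ x y → x + g < y) zs
      zs-spread = AllPairs-resp-⊆ zs⊆ right-spread

      red-edges : All (RedEdge Q x) zs
      red-edges = All.tabulate λ z∈ → left<right x∈ (⊆-lookup zs⊆ z∈) , All.lookup reds z∈

      fan-wins : Wins (j * (n * d) + n * n) Q
      fan-wins with separated n 1≤n zs-spread (m+n≤o⇒m≤o n n+n≤)
      ... | b , ≤b , b< = extend j record
        { apex        = x
        ; b           = b
        ; l           = 1
        ; ends        = take n zs
        ; tips        = take n (drop n zs)
        ; ends-length = length-take-≤ zs (m+n≤o⇒m≤o n n+n≤)
        ; tips-length = length-take-≤ (drop n zs)
            (subst (n ≤_) (sym (length-drop n zs)) (m+n≤o⇒m≤o∸n n n+n≤))
        ; ends-sorted = AllPairs.take⁺ n (spread⇒sorted zs-spread)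
        ; tips-sorted = AllPairs.take⁺ n (AllPairs.drop⁺ n (spread⇒sorted zs-spread))
        ; n≤ends      = All.tabulate (λ y∈ → n≤right (⊆-lookup zs⊆ (⊆-lookup (take-⊆ n zs) y∈)))
        ; ends≤b      = ≤b
        ; gap         = All.take⁺ n b<
        ; paths       = All.map RedPath-edge (All.take⁺ n red-edges)
        ; chords      = All.take⁺ n (All.drop⁺ n red-edges)
        -- With paths of one edge, `2 + (1 + j)` is `3 + j` by computation.
        ; edge-count  = k≡
        ; origin      = λ e → [ (λ ()) , (λ (u∈ , _) → inj₁ (∈-upTo⁻ u∈)) ]′ (new e)
        }

-- Counting the turns

bound-≡ : ∀ n d → suc d ≡ n + n → ∀ j →
  n * (n * d + n) + (j * (n * d) + n * n) ≡ 2 * n ^ 3 + j * (n * (2 * n ∸ 1)) + n ^ 2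
bound-≡ n d 1+d≡n+n j = begin
  -- The summands are the costs of the opening, the `j` extension rounds and the final join. Here
  -- `n * d + n` is `n * suc d`, that is `2n²`.
  n * (n * d + n) + (j * (n * d) + n * n)
    ≡⟨ expand n d j ⟩
  n * n * suc d + j * (n * d) + n ^ 2
    ≡⟨ cong₂ (λ s t → n * n * s + j * (n * t) + n ^ 2) 1+d≡n+n d≡ ⟩
  n * n * (n + n) + j * (n * (2 * n ∸ 1)) + n ^ 2
    ≡⟨ cube n (j * (n * (2 * n ∸ 1))) ⟩
  2 * n ^ 3 + j * (n * (2 * n ∸ 1)) + n ^ 2 ∎
  where
  open ≡-Reasoning

  d≡ : d ≡ 2 * n ∸ 1
  d≡ = trans (cong (_∸ 1) 1+d≡n+n) (cong (λ m → n + m ∸ 1) (sym (+-identityʳ n)))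

  -- n * (n * 1) is n ^ 2 unfolded: the ring solver fails on _^_.
  expand : ∀ n d j → n * (n * d + n) + (j * (n * d) + n * n) ≡
                     n * n * suc d + j * (n * d) + n * (n * 1)
  expand = solve-∀

  cube : ∀ n t → n * n * (n + n) + t + n * (n * 1) ≡ 2 * (n * (n * (n * 1))) + t + n * (n * 1)
  cube = solve-∀

theorem4 : (k n : ℕ) → 3 ≤ k → 1 ≤ n →
    ∃[ r ] (IsOnlineOrderedRamseyNumber (C k) (K n) r ×
    r ≤ 2 * n ^ 3 + (k ∸ 3) * (n * (2 * n ∸ 1)) + n ^ 2)
theorem4 (suc (suc (suc j))) (suc n′) (s≤s (s≤s (s≤s _))) 1≤n =
  onlineOrderedRamseyNumber-≤ (C k) (K n) (C-E? k) (K-E? n)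
    -- For `n = suc n′` the value `n′ + n` is `2n - 1`, and the equation required of `d` holds by
    -- computation.
    (subst (λ m → BuilderWins (C k) (K n) m []) (bound-≡ n (n′ + n) refl j)
      (Strategy.start k n (n′ + n) refl 1≤n j refl))
  where
  k = 3 + j
  n = suc n′
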